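{- For each of the following sets $R\subseteq\{0,1,2,3\}^2$ we have $(123,R)\sim_d(132,R)$: (1) $R=\{(0,0),(0,1),(0,2),(1,0),(2,0),(2,2)\}$; (2) $R=\{(0,0),(0,1),(0,2),(1,0),(1,2),(2,0),(2,1),(2,3),(3,2)\}$; (3) $R=\{(0,0),(0,1),(0,2),(1,0),(1,1),(1,3),(2,0),(3,1),(3,3)\}$; (4) $R=\{(0,0),(0,1),(0,2),(1,0),(1,1),(1,3),(2,0),(2,2),(3,1),(3,3)\}$; (5) $R=\{(0,0),(0,1),(0,2),(1,0),(1,2),(2,0),(2,1),(2,2),(2,3),(3,2)\}$; (6) $R=\{(0,0),(0,1),(0,2),(1,0),(1,1),(1,2),(1,3),(2,0),(2,1),(2,3),(3,1),(3,2),(3,3)\}$; (7) $R=\{(0,0),(0,1),(0,2),(1,0),(1,1),(1,2),(1,3),(2,0),(2,1),(2,2),(2,3),(3,1),(3,2),(3,3)\}$.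
   Context: $S_n$ denotes the set of permutations of $[n]=\{1,\dots,n\}$, written $\pi=\pi_1\cdots\pi_n$. A mesh pattern of length $k$ is a pair $(\tau,R)$ with $\tau\in S_k$ and $R\subseteq\{0,1,\dots,k\}^2$ (the shaded boxes; box $(a,b)$ is the unit square $[a,a+1]\times[b,b+1]$ in the diagram of $\tau$). An occurrence of $(\tau,R)$ in $\pi\in S_n$ is a choice of indices $i_1<\dots<i_k$ such that $\pi_{i_1}\cdots\pi_{i_k}$ is order-isomorphic to $\tau$ and, with $i_0=0$, $i_{k+1}=n+1$, $v_1<\dots<v_k$ the values $\pi_{i_1},\dots,\pi_{i_k}$ sorted increasingly, $v_0=0$, $v_{k+1}=n+1$, for every $(a,b)\in R$ there is no index $m$ with $i_a<m<i_{a+1}$ and $v_b<\pi_m<v_{b+1}$. Mesh patterns $p,q$ are equidistributed, $p\sim_d q$, if for all $n,\ell\ge0$ the number of $\pi\in S_n$ with exactly $\ell$ occurrences of $p$ equals the number with exactly $\ell$ occurrences of $q$. -}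

module Defs where

open import Data.Nat using (ℕ; zero; suc; _+_; _<ᵇ_; _≡ᵇ_; _≤ᵇ_)
open import Data.Bool using (Bool; true; false; _∧_; _∨_; not; if_then_else_)
open import Data.List using (List; []; _∷_; _++_; length; map; filter; upTo; concatMap; foldr)
open import Data.Bool.ListAction using (all; any)
open import Data.Product using (_×_; _,_; proj₁)
open import Relation.Binary.PropositionalEquality using (_≡_)

-- Permutations are represented in one-line notation as lists of naturals
-- π = π₁ ⋯ πₙ (values in 1..n).  Indices are 1-based.

range1 : ℕ → List ℕ
range1 n = map suc (upTo n)

-- m-th entry (1-based) of a list; default 0 when out of range
nth : List ℕ → ℕ → ℕ
nth []       _             = 0
nth (x ∷ xs) zero          = 0
nth (x ∷ xs) (suc zero)    = x
nth (x ∷ xs) (suc (suc m)) = nth xs (suc m)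

words : ℕ → List ℕ → List (List ℕ)
words zero    vs = [] ∷ []
words (suc k) vs = concatMap (λ v → map (v ∷_) (words k vs)) vs

elemᵇ : ℕ → List ℕ → Bool
elemᵇ v xs = any (λ x → x ≡ᵇ v) xs

-- a word of length n over [n] is a permutation iff every value of [n] occurs
isPermᵇ : ℕ → List ℕ → Bool
isPermᵇ n w = all (λ v → elemᵇ v w) (range1 n)

filterᵇ : {A : Set} → (A → Bool) → List A → List A
filterᵇ p []       = []
filterᵇ p (x ∷ xs) = if p x then x ∷ filterᵇ p xs else filterᵇ p xs

-- S_n, as an explicit list (each permutation exactly once)
perms : ℕ → List (List ℕ)
perms n = filterᵇ (isPermᵇ n) (words n (range1 n))

choose : ℕ → List ℕ → List (List ℕ)
choose zero    xs       = [] ∷ []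
choose (suc k) []       = []
choose (suc k) (x ∷ xs) = map (x ∷_) (choose k xs) ++ choose (suc k) xs

insert : ℕ → List ℕ → List ℕ
insert x []       = x ∷ []
insert x (y ∷ ys) = if x ≤ᵇ y then x ∷ y ∷ ys else y ∷ insert x ys

sortℕ : List ℕ → List ℕ
sortℕ = foldr insert []

allPairs : List ℕ → List (ℕ × ℕ)
allPairs xs = concatMap (λ a → map (a ,_) (range1 (length xs))) (range1 (length xs))

boolEq : Bool → Bool → Bool
boolEq true  true  = true
boolEq false false = true
boolEq _     _     = false

orderIsoᵇ : List ℕ → List ℕ → Bool
orderIsoᵇ xs ys =
  (length xs ≡ᵇ length ys) ∧
  all (λ { (a , b) → boolEq (nth xs a <ᵇ nth xs b) (nth ys a <ᵇ nth ys b) }) (allPairs xs)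

-- A mesh pattern (τ, R): τ in one-line notation, R a list of shaded boxes (a , b).
MeshPattern : Set
MeshPattern = List ℕ × List (ℕ × ℕ)

-- Is the increasing index list `is` an occurrence of (τ, R) in π ∈ S_n?
-- Boundary conventions i₀ = 0, i_{k+1} = n+1, v₀ = 0, v_{k+1} = n+1.
isOccᵇ : ℕ → List ℕ → MeshPattern → List ℕ → Bool
isOccᵇ n π (τ , R) is =
  orderIsoᵇ (map (nth π) is) τ ∧ all boxEmpty R
  where
  iext : List ℕ
  iext = 0 ∷ (is ++ (suc n ∷ []))
  vext : List ℕ
  vext = 0 ∷ (sortℕ (map (nth π) is) ++ (suc n ∷ []))
  -- 0-based access to the extended lists
  I : ℕ → ℕ
  I a = nth iext (suc a)
  V : ℕ → ℕ
  V b = nth vext (suc b)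
  boxEmpty : ℕ × ℕ → Bool
  boxEmpty (a , b) =
    not (any (λ m → (I a <ᵇ m) ∧ (m <ᵇ I (suc a)) ∧ (V b <ᵇ nth π m) ∧ (nth π m <ᵇ V (suc b)))
             (range1 n))

occurrences : ℕ → MeshPattern → List ℕ → ℕ
occurrences n p π = length (filterᵇ (isOccᵇ n π p) (choose (length (proj₁ p)) (range1 n)))

countWith : MeshPattern → ℕ → ℕ → ℕ
countWith p n ℓ = length (filterᵇ (λ π → occurrences n p π ≡ᵇ ℓ) (perms n))

_∼d_ : MeshPattern → MeshPattern → Set
p ∼d q = (n ℓ : ℕ) → countWith p n ℓ ≡ countWith q n ℓ

{-# OPTIONS --safe #-}
module Submission where

-- The boxes (0,0), (0,1), (0,2), (1,0), (2,0) force the first letter of an occurrence to be a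
-- left-to-right minimum and the other two to lie before the next one.  Reverse the order of the
-- letters strictly between any two consecutive left-to-right minima: this involution keeps the
-- left-to-right minima in place, and on each occurrence it swaps the last two letters, so it
-- exchanges 123 and 132.  An emptiness condition survives because columns 1 and 3 are always
-- shaded in the same rows, so that their union, the complement of column 2 to the right of the
-- first letter, is mapped to itself.

open import Defs
open import Data.Bool using (Bool; true; false; T; not; _∧_)
open import Data.Bool.ListAction using (all; any)
open import Data.Bool.Properties using (T-∧)
open import Data.Empty using (⊥; ⊥-elim)
open import Data.List using (List; []; _∷_; _++_; length; map; upTo; applyUpTo; concatMap; cartesianProductWith)
open import Data.List.Properties using (∷-injective; ∷-injectiveˡ; ∷-injectiveʳ; length-map; length-upTo; length-++-sucʳ)
import Data.List.Membership.DecPropositional as DecMembership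
open import Data.List.Membership.Propositional using (_∈_; find; lose)
open import Data.List.Membership.Propositional.Properties
  using (∈-∃++; ∈-++⁺ˡ; ∈-++⁺ʳ; ∈-++⁻; ∈-map⁺; ∈-map⁻; ∈-upTo⁺; ∈-upTo⁻; ∈-cartesianProductWith⁺; ∈-cartesianProductWith⁻)
open import Data.List.Relation.Binary.Disjoint.Propositional using (Disjoint)
open import Data.List.Relation.Binary.Subset.Propositional using (_⊆_)
open import Data.List.Relation.Unary.All as All using (All; []; _∷_)
open import Data.List.Relation.Unary.All.Properties using (all⁺; all⁻)
open import Data.List.Relation.Unary.AllPairs as AllPairs using (AllPairs; []; _∷_)
open import Data.List.Relation.Unary.AllPairs.Properties using (applyUpTo⁺₁) renaming (map⁺ to AllPairs-map⁺)
open import Data.List.Relation.Unary.Any using (here; there)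
open import Data.List.Relation.Unary.Any.Properties using (any⁺; any⁻)
open import Data.List.Relation.Unary.Unique.Propositional using (Unique)
import Data.List.Relation.Unary.Unique.Propositional.Properties as Unique
open import Data.Nat using (ℕ; zero; suc; _+_; _∸_; _≤_; _<_; _<ᵇ_; _≤ᵇ_; _≡ᵇ_; z≤n; s≤s; z<s; _≤?_; _<?_)
open import Data.Nat.Induction using (<-rec)
open import Data.Nat.Properties
open import Data.Product using (_×_; _,_; proj₁; proj₂; ∃-syntax; ∃₂)
open import Data.Product.Properties using (≡-dec)
open import Data.Sum using (_⊎_; inj₁; inj₂)
open import Data.Unit using (tt)
open import Function using (_∘_; id; Equivalence)
open import Relation.Binary.Definitions using (tri<; tri≈; tri>)
open import Relation.Binary.PropositionalEquality
open import Relation.Nullary using (¬_; Dec; yes; no; contradiction)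
open import Relation.Nullary.Decidable using (_→-dec_; _×-dec_; _⊎-dec_; True; toWitness)

-- Counting by injections

-- Pigeonhole by induction on `xs`: one copy of `f x` is cut out of `ys`, and injectivity on the
-- entries of `xs` keeps the remaining images in what is left.
length-≤-injection : {A B : Set} {xs : List A} {ys : List B} (f : A → B) → Unique xs →
  (∀ {x} → x ∈ xs → f x ∈ ys) →
  (∀ {x y} → x ∈ xs → y ∈ xs → f x ≡ f y → x ≡ y) →
  length xs ≤ length ys
length-≤-injection {xs = []} f [] into inj = z≤n
length-≤-injection {xs = x ∷ xs} f (x∉ ∷ uniq) into inj
  with ys₁ , ys₂ , refl ← ∈-∃++ (into (here refl)) =
  subst (suc (length xs) ≤_) (sym (length-++-sucʳ ys₁ (f x) ys₂))
    (s≤s (length-≤-injection f uniq into′ λ p q → inj (there p) (there q)))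
  where
  into′ : ∀ {x′} → x′ ∈ xs → f x′ ∈ ys₁ ++ ys₂
  into′ {x′} p with ∈-++⁻ ys₁ (into (there p))
  ... | inj₁ q = ∈-++⁺ˡ q
  ... | inj₂ (there q) = ∈-++⁺ʳ ys₁ q
  ... | inj₂ (here eq) =
    contradiction (inj (here refl) (there p) (sym eq)) (All.lookup x∉ p)

length-≤-⊆ : {A : Set} {xs ys : List A} → Unique xs → xs ⊆ ys → length xs ≤ length ys
length-≤-⊆ uniq sub = length-≤-injection id uniq sub λ _ _ → id

module _ {A : Set} (p : A → Bool) where

  ∈-filterᵇ⁺ : ∀ {x xs} → x ∈ xs → T (p x) → x ∈ filterᵇ p xs
  ∈-filterᵇ⁺ {xs = x ∷ xs} (here refl) px with true ← p x = here refl
  ∈-filterᵇ⁺ {xs = x ∷ xs} (there q) px with p x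
  ... | true  = there (∈-filterᵇ⁺ q px)
  ... | false = ∈-filterᵇ⁺ q px

  ∈-filterᵇ⁻ : ∀ {x} xs → x ∈ filterᵇ p xs → x ∈ xs × T (p x)
  ∈-filterᵇ⁻ (x ∷ xs) q with p x in eq
  ∈-filterᵇ⁻ (x ∷ xs) (here refl) | true  = here refl , subst T (sym eq) tt
  ∈-filterᵇ⁻ (x ∷ xs) (there q)   | true  = let r , t = ∈-filterᵇ⁻ xs q in there r , t
  ∈-filterᵇ⁻ (x ∷ xs) q           | false = let r , t = ∈-filterᵇ⁻ xs q in there r , t

  filterᵇ-unique : ∀ {xs} → Unique xs → Unique (filterᵇ p xs)
  filterᵇ-unique [] = []
  filterᵇ-unique {x ∷ xs} (x∉ ∷ uniq) with p x
  ... | true  = All.tabulate (λ q → All.lookup x∉ (proj₁ (∈-filterᵇ⁻ xs q))) ∷ filterᵇ-unique uniq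
  ... | false = filterᵇ-unique uniq

-- The lists enumerating words, permutations and index triples

InRange : ℕ → ℕ → Set
InRange n m = 1 ≤ m × m ≤ n

∈-range1⁺ : ∀ {n m} → InRange n m → m ∈ range1 n
∈-range1⁺ {m = suc m} (_ , m<n) = ∈-map⁺ suc (∈-upTo⁺ m<n)

∈-range1⁻ : ∀ {n m} → m ∈ range1 n → InRange n m
∈-range1⁻ q with _ , r , refl ← ∈-map⁻ suc q = s≤s z≤n , ∈-upTo⁻ r

range1-unique : ∀ n → Unique (range1 n)
range1-unique n = Unique.map⁺ suc-injective (Unique.upTo⁺ n)

range1-sorted : ∀ n → AllPairs _<_ (range1 n)
range1-sorted n = AllPairs-map⁺ (applyUpTo⁺₁ id n λ i<j _ → s≤s i<j)

length-range1 : ∀ n → length (range1 n) ≡ n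
length-range1 n = trans (length-map suc (upTo n)) (length-upTo n)

-- Puts `words` into the form of a cartesian product, for which uniqueness and membership are known.
words-suc : ∀ k vs → words (suc k) vs ≡ cartesianProductWith _∷_ vs (words k vs)
words-suc k vs = go vs
  where
  go : ∀ us → concatMap (λ v → map (v ∷_) (words k vs)) us ≡ cartesianProductWith _∷_ us (words k vs)
  go []       = refl
  go (u ∷ us) = cong (map (u ∷_) (words k vs) ++_) (go us)

words-unique : ∀ k {vs} → Unique vs → Unique (words k vs)
words-unique zero    uniq = [] ∷ []
words-unique (suc k) {vs} uniq rewrite words-suc k vs =
  Unique.cartesianProductWith⁺ _∷_ ∷-injective uniq (words-unique k uniq)

∈-words⁺ : ∀ {vs} w → w ⊆ vs → w ∈ words (length w) vs
∈-words⁺ [] sub = here refl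
∈-words⁺ {vs} (v ∷ w) sub rewrite words-suc (length w) vs =
  ∈-cartesianProductWith⁺ _∷_ (sub (here refl)) (∈-words⁺ w (sub ∘ there))

∈-words⁻ : ∀ k {vs w} → w ∈ words k vs → length w ≡ k × w ⊆ vs
∈-words⁻ zero (here refl) = refl , λ ()
∈-words⁻ (suc k) {vs} q rewrite words-suc k vs
  with _ , _ , r , s , refl ← ∈-cartesianProductWith⁻ _∷_ vs (words k vs) q
  with len , sub ← ∈-words⁻ k s =
  cong suc len , λ { (here refl) → r ; (there t) → sub t }

∈-choose⁻ : ∀ k {xs is} → is ∈ choose k xs → length is ≡ k × is ⊆ xs
∈-choose⁻ zero (here refl) = refl , λ ()
∈-choose⁻ (suc k) {x ∷ xs} q with ∈-++⁻ (map (x ∷_) (choose k xs)) q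
... | inj₂ r = let len , sub = ∈-choose⁻ (suc k) r in len , there ∘ sub
... | inj₁ r with _ , s , refl ← ∈-map⁻ (x ∷_) r with len , sub ← ∈-choose⁻ k s =
  cong suc len , λ { (here refl) → here refl ; (there t) → there (sub t) }

choose-sorted : ∀ k {xs is} → AllPairs _<_ xs → is ∈ choose k xs → AllPairs _<_ is
choose-sorted zero sorted (here refl) = []
choose-sorted (suc k) {x ∷ xs} (x< ∷ sorted) q with ∈-++⁻ (map (x ∷_) (choose k xs)) q
... | inj₂ r = choose-sorted (suc k) sorted r
... | inj₁ r with _ , s , refl ← ∈-map⁻ (x ∷_) r =
  All.tabulate (All.lookup x< ∘ proj₂ (∈-choose⁻ k s)) ∷ choose-sorted k sorted s

-- For strictly increasing lists inclusion already gives a sublist: if the head `i` is not `x`, it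
-- lies further on and exceeds `x`, so `x` cannot occur in `i ∷ is`.
∈-choose⁺ : ∀ {xs is} → AllPairs _<_ xs → AllPairs _<_ is → is ⊆ xs → is ∈ choose (length is) xs
∈-choose⁺ {is = []} _ _ _ = here refl
∈-choose⁺ {[]} {i ∷ is} _ _ sub with () ← sub (here refl)
∈-choose⁺ {x ∷ xs} {i ∷ is} (x< ∷ sx) (i< ∷ si) sub with sub (here refl)
... | here refl = ∈-++⁺ˡ (∈-map⁺ (x ∷_) (∈-choose⁺ sx si sub′))
  where
  sub′ : is ⊆ xs
  sub′ q with sub (there q)
  ... | here refl = contradiction (All.lookup i< q) (<-irrefl refl)
  ... | there r   = r
... | there i∈ = ∈-++⁺ʳ (map (x ∷_) (choose (length is) xs)) (∈-choose⁺ sx (i< ∷ si) sub′)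
  where
  sub′ : i ∷ is ⊆ xs
  sub′ (here refl) = i∈
  sub′ (there q) with sub (there q)
  ... | here refl = contradiction (<-trans (All.lookup i< q) (All.lookup x< i∈)) (<-irrefl refl)
  ... | there r   = r

choose-unique : ∀ k {xs} → Unique xs → Unique (choose k xs)
choose-unique zero _ = [] ∷ []
choose-unique (suc k) [] = []
choose-unique (suc k) {x ∷ xs} (x∉ ∷ uniq) =
  Unique.++⁺ (Unique.map⁺ ∷-injectiveʳ (choose-unique k uniq)) (choose-unique (suc k) uniq) disjoint
  where
  disjoint : Disjoint (map (x ∷_) (choose k xs)) (choose (suc k) xs)
  disjoint (p , q) with _ , _ , refl ← ∈-map⁻ (x ∷_) p =
    All.lookup x∉ (proj₂ (∈-choose⁻ (suc k) q) (here refl)) refl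

-- One-line notation

nth-∈ : ∀ {xs m} → InRange (length xs) m → nth xs m ∈ xs
nth-∈ {x ∷ xs} {suc zero} _ = here refl
nth-∈ {x ∷ xs} {suc (suc m)} (_ , s≤s le) = there (nth-∈ {xs} (s≤s z≤n , le))

∈-nth : ∀ {xs v} → v ∈ xs → ∃[ m ] InRange (length xs) m × nth xs m ≡ v
∈-nth (here refl) = 1 , (s≤s z≤n , s≤s z≤n) , refl
∈-nth (there q) with suc m , (_ , le) , eq ← ∈-nth q = suc (suc m) , (s≤s z≤n , s≤s le) , eq

nth-overflow : ∀ {xs m} → length xs < m → nth xs m ≡ 0
nth-overflow {[]} _ = refl
nth-overflow {x ∷ xs} {suc (suc m)} (s≤s lt) = nth-overflow {xs} lt

nth-map : ∀ (g : ℕ → ℕ) {xs m} → InRange (length xs) m → nth (map g xs) m ≡ g (nth xs m)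
nth-map g {x ∷ xs} {suc zero} _ = refl
nth-map g {x ∷ xs} {suc (suc m)} (_ , s≤s le) = nth-map g {xs} (s≤s z≤n , le)

nth-applyUpTo : ∀ (g : ℕ → ℕ) {n m} → m < n → nth (applyUpTo g n) (suc m) ≡ g m
nth-applyUpTo g {suc n} {zero} _ = refl
nth-applyUpTo g {suc n} {suc m} (s≤s lt) = nth-applyUpTo (g ∘ suc) lt

nth-range1 : ∀ {n m} → InRange n m → nth (range1 n) m ≡ m
nth-range1 {n} {suc m} (1≤m , m<n) = trans
  (nth-map suc {upTo n} (1≤m , subst (suc m ≤_) (sym (length-upTo n)) m<n))
  (cong suc (nth-applyUpTo id m<n))

nth-ext : ∀ {xs ys} → length xs ≡ length ys →
  (∀ {m} → InRange (length xs) m → nth xs m ≡ nth ys m) → xs ≡ ys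
nth-ext {[]} {[]} _ _ = refl
nth-ext {x ∷ xs} {y ∷ ys} len eq =
  cong₂ _∷_ (eq {1} (s≤s z≤n , s≤s z≤n))
    (nth-ext (suc-injective len) λ { {suc m} (_ , le) → eq {suc (suc m)} (s≤s z≤n , s≤s le) })

nth-duplicate : ∀ {xs p q} → 1 ≤ p → p < q → q ≤ length xs → nth xs p ≡ nth xs q →
  ∃[ ys ] suc (length ys) ≡ length xs × xs ⊆ ys
nth-duplicate {p = suc _} {suc zero} _ (s≤s ())
nth-duplicate {x ∷ xs} {suc zero} {suc (suc q)} _ _ (s≤s le) eq =
  xs , refl , λ { (here refl) → subst (_∈ xs) (sym eq) (nth-∈ {xs} (s≤s z≤n , le)) ; (there r) → r }
nth-duplicate {x ∷ xs} {suc (suc p)} {suc (suc q)} _ (s≤s lt) (s≤s le) eq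
  with ys , len , sub ← nth-duplicate {xs} {suc p} {suc q} (s≤s z≤n) lt le eq =
  x ∷ ys , cong suc len , λ { (here refl) → here refl ; (there r) → there (sub r) }

-- Permutations as words

record IsPermutation (n : ℕ) (π : List ℕ) : Set where
  field
    length≡  : length π ≡ n
    bounded  : π ⊆ range1 n
    complete : range1 n ⊆ π

  inRange : ∀ {m} → InRange n m → InRange n (nth π m)
  inRange (lo , hi) = ∈-range1⁻ (bounded (nth-∈ (lo , subst (_ ≤_) (sym length≡) hi)))

  private
    no-duplicate : ∀ {p q} → 1 ≤ p → p < q → q ≤ n → nth π p ≢ nth π q
    no-duplicate 1≤p p<q q≤n eq
      with ys , len , sub ← nth-duplicate 1≤p p<q (subst (_ ≤_) (sym length≡) q≤n) eq =
      <-irrefl refl (begin-strict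
        length ys         <⟨ ≤-reflexive len ⟩
        length π          ≡⟨ trans length≡ (sym (length-range1 n)) ⟩
        length (range1 n) ≤⟨ length-≤-⊆ (range1-unique n) (sub ∘ complete) ⟩
        length ys         ∎)
      where open ≤-Reasoning

  nth-injective : ∀ {p q} → InRange n p → InRange n q → nth π p ≡ nth π q → p ≡ q
  nth-injective {p} {q} (1≤p , p≤n) (1≤q , q≤n) eq with <-cmp p q
  ... | tri≈ _ p≡q _ = p≡q
  ... | tri< p<q _ _ = contradiction eq (no-duplicate 1≤p p<q q≤n)
  ... | tri> _ _ q<p = contradiction (sym eq) (no-duplicate 1≤q q<p p≤n)

elemᵇ⁺ : ∀ {v xs} → v ∈ xs → T (elemᵇ v xs)
elemᵇ⁺ {v} q = any⁺ _ (lose q (≡⇒≡ᵇ v v refl))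

elemᵇ⁻ : ∀ {v} xs → T (elemᵇ v xs) → v ∈ xs
elemᵇ⁻ xs t with x , q , e ← find (any⁻ _ xs t) = subst (_∈ xs) (≡ᵇ⇒≡ x _ e) q

∈-perms⁺ : ∀ {n π} → IsPermutation n π → π ∈ perms n
∈-perms⁺ {n} {π} perm = ∈-filterᵇ⁺ (isPermᵇ n)
  (subst (λ k → π ∈ words k (range1 n)) length≡ (∈-words⁺ π bounded))
  (all⁻ _ (All.tabulate (elemᵇ⁺ ∘ complete)))
  where open IsPermutation perm

∈-perms⁻ : ∀ {n π} → π ∈ perms n → IsPermutation n π
∈-perms⁻ {n} {π} q with w , t ← ∈-filterᵇ⁻ (isPermᵇ n) (words n (range1 n)) q
  with len , sub ← ∈-words⁻ n w = record
  { length≡  = len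
  ; bounded  = sub
  ; complete = λ r → elemᵇ⁻ π (All.lookup (all⁺ _ (range1 n) t) r)
  }

perms-unique : ∀ n → Unique (perms n)
perms-unique n = filterᵇ-unique (isPermᵇ n) (words-unique n (range1-unique n))

-- Left-to-right minima

-- Positions start at 1, so `0` and `1` qualify vacuously. Position `0` gives the leftward search
-- for a minimum a place to stop; position `1` is the genuine first minimum.
LRMin : (ℕ → ℕ) → ℕ → Set
LRMin f m = ∀ k → k < m → 1 ≤ k → f m < f k

lrMin? : ∀ f m → Dec (LRMin f m)
lrMin? f m with allUpTo? (λ k → (1 ≤? k) →-dec (f m <? f k)) m
... | yes min = yes λ _ → min
... | no ¬min = no λ min → ¬min (min _)

-- The strip is the open interval between two consecutive minima; `e` may be `n + 1`, which closes
-- the last strip.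
record Strip (f : ℕ → ℕ) (n i e : ℕ) : Set where
  field
    minˡ     : LRMin f i
    minʳ     : LRMin f e
    e≤1+n    : e ≤ suc n
    interior : ∀ {m} → i < m → m < e → ¬ LRMin f m

stripStart : (ℕ → ℕ) → ℕ → ℕ
stripStart f zero = zero
stripStart f (suc m) with lrMin? f (suc m)
... | yes _ = suc m
... | no  _ = stripStart f m

-- The first argument is fuel, the number of positions left up to `n`. When it runs out, `m` is `n`,
-- and the answer `suc m` is the closing minimum `n + 1`.
searchMin : (ℕ → ℕ) → ℕ → ℕ → ℕ
searchMin f zero    m = suc m
searchMin f (suc d) m with lrMin? f (suc m)
... | yes _ = suc m
... | no  _ = searchMin f d (suc m)

stripEnd : (ℕ → ℕ) → ℕ → ℕ → ℕ
stripEnd f n m = searchMin f (n ∸ m) m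

-- On a strip between `i` and `e` the formula `i + e ∸ m` is the reflection in its midpoint.
reflect : (ℕ → ℕ) → ℕ → ℕ → ℕ
reflect f n m with lrMin? f m
... | yes _ = m
... | no  _ = stripStart f m + stripEnd f n m ∸ m

module StripReversal (f : ℕ → ℕ) (n : ℕ)
  (f-pos : ∀ {m} → InRange n m → 1 ≤ f m) (f-end : f (suc n) ≡ 0) where

  lrMin-zero : LRMin f 0
  lrMin-zero _ ()

  lrMin-one : LRMin f 1
  lrMin-one _ (s≤s z≤n) ()

  -- nth is 0 beyond the end of a word, which makes n + 1 a left-to-right minimum closing the last strip.
  lrMin-end : LRMin f (suc n)
  lrMin-end _ (s≤s k≤n) 1≤k = subst (_< f _) (sym f-end) (f-pos (1≤k , k≤n))

  stripStart-spec : ∀ m → let i = stripStart f m in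
    i ≤ m × LRMin f i × (∀ {k} → i < k → k ≤ m → ¬ LRMin f k)
  stripStart-spec zero = z≤n , lrMin-zero , λ { () z≤n }
  stripStart-spec (suc m) with lrMin? f (suc m)
  ... | yes min = ≤-refl , min , λ lt le → contradiction le (<⇒≱ lt)
  ... | no ¬min with i≤m , min , none ← stripStart-spec m =
    m≤n⇒m≤1+n i≤m , min , none′
    where
    none′ : ∀ {k} → stripStart f m < k → k ≤ suc m → ¬ LRMin f k
    none′ lt le with m≤n⇒m<n∨m≡n le
    ... | inj₁ (s≤s le′) = none lt le′
    ... | inj₂ refl      = ¬min

  searchMin-spec : ∀ d m → m + d ≡ n → let e = searchMin f d m in
    m < e × e ≤ suc n × LRMin f e × (∀ {k} → m < k → k < e → ¬ LRMin f k)
  searchMin-spec zero m eq rewrite trans (sym (+-identityʳ m)) eq =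
    ≤-refl , ≤-refl , lrMin-end , λ lt le → contradiction le (≤⇒≯ lt)
  searchMin-spec (suc d) m eq with lrMin? f (suc m)
  ... | yes min = ≤-refl , s≤s (subst (m ≤_) eq (m≤m+n m (suc d))) , min , λ lt le → contradiction le (≤⇒≯ lt)
  ... | no ¬min with lt , le , min , none ← searchMin-spec d (suc m) (trans (sym (+-suc m d)) eq) =
    <-trans (n<1+n m) lt , le , min , none′
    where
    none′ : ∀ {k} → m < k → k < searchMin f d (suc m) → ¬ LRMin f k
    none′ lt′ le′ with m≤n⇒m<n∨m≡n lt′
    ... | inj₁ lt″  = none lt″ le′
    ... | inj₂ refl = ¬min

  -- The left end is a parameter because it has two sources: the search from `m`, and the first
  -- position of an occurrence whose last position is `m`.
  extend-strip : ∀ {i m} → LRMin f i → i ≤ m → m ≤ n → (∀ {k} → i < k → k ≤ m → ¬ LRMin f k) →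
    m < stripEnd f n m × Strip f n i (stripEnd f n m)
  extend-strip {i} {m} min i≤m m≤n none
    with lt , le , minʳ , none′ ← searchMin-spec (n ∸ m) m (m+[n∸m]≡n m≤n) =
    lt , record { minˡ = min ; minʳ = minʳ ; e≤1+n = le ; interior = interior }
    where
    interior : ∀ {k} → i < k → k < stripEnd f n m → ¬ LRMin f k
    interior {k} lt le with k ≤? m
    ... | yes k≤m = none lt k≤m
    ... | no  k≰m = none′ (≰⇒> k≰m) le

  strip-around : ∀ {m} → ¬ LRMin f m → m ≤ n →
    stripStart f m < m × m < stripEnd f n m × Strip f n (stripStart f m) (stripEnd f n m)
  strip-around {m} ¬min m≤n with i≤m , min , none ← stripStart-spec m =
    ≤∧≢⇒< i≤m (λ eq → ¬min (subst (LRMin f) eq min)) , extend-strip min i≤m m≤n none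

  -- Both strips contain `m`, so if two corresponding ends differed, one of them would be a minimum
  -- in the interior of the other strip.
  strip-unique : ∀ {i e i′ e′ m} → Strip f n i e → Strip f n i′ e′ →
    i < m → m < e → i′ < m → m < e′ → i ≡ i′ × e ≡ e′
  strip-unique {i} {e} {i′} {e′} S S′ i<m m<e i′<m m<e′ = left , right
    where
    module S = Strip S
    module S′ = Strip S′
    left : i ≡ i′
    left with <-cmp i i′
    ... | tri≈ _ eq _ = eq
    ... | tri< lt _ _ = contradiction S′.minˡ (S.interior lt (<-trans i′<m m<e))
    ... | tri> _ _ lt = contradiction S.minˡ (S′.interior lt (<-trans i<m m<e′))
    right : e ≡ e′
    right with <-cmp e e′
    ... | tri≈ _ eq _ = eq
    ... | tri< lt _ _ = contradiction S.minʳ (S′.interior (<-trans i′<m m<e) lt)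
    ... | tri> _ _ lt = contradiction S′.minʳ (S.interior (<-trans i<m m<e′) lt)

  -- The reflection of positions

  ρ : ℕ → ℕ
  ρ = reflect f n

  ρ-min : ∀ {m} → LRMin f m → ρ m ≡ m
  ρ-min {m} min with lrMin? f m
  ... | yes _   = refl
  ... | no ¬min = contradiction min ¬min

  ρ-interior : ∀ {i e m} → Strip f n i e → i < m → m < e → ρ m ≡ i + e ∸ m
  ρ-interior {i} {e} {m} S i<m m<e with lrMin? f m
  ... | yes min = contradiction min (Strip.interior S i<m m<e)
  ... | no ¬min with lo , hi , S′ ← strip-around ¬min (≤-pred (<-≤-trans m<e (Strip.e≤1+n S)))
    with refl , refl ← strip-unique S S′ i<m m<e lo hi = refl

  module _ {i e} (S : Strip f n i e) where

    private
      ∸-lower : ∀ {m} → m < e → i < i + e ∸ m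
      ∸-lower {m} m<e = subst (i <_) (sym (+-∸-assoc i (<⇒≤ m<e))) (m<m+n i (m<n⇒0<n∸m m<e))

      ∸-upper : ∀ {m} → i < m → m < e → i + e ∸ m < e
      ∸-upper {m} i<m m<e = subst (i + e ∸ m <_) (m+n∸m≡n i e) (∸-monoʳ-< i<m (≤-trans (<⇒≤ m<e) (m≤n+m e i)))

    ρ-stays : ∀ {m} → i < m → m < e → i < ρ m × ρ m < e
    ρ-stays i<m m<e rewrite ρ-interior S i<m m<e = ∸-lower m<e , ∸-upper i<m m<e

    ρ-reverses : ∀ {m k} → i < m → m < k → k < e → ρ k < ρ m
    ρ-reverses i<m m<k k<e
      rewrite ρ-interior S i<m (<-trans m<k k<e) | ρ-interior S (<-trans i<m m<k) k<e =
      ∸-monoʳ-< m<k (≤-trans (<⇒≤ k<e) (m≤n+m e i))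

    ρ-involutive-interior : ∀ {m} → i < m → m < e → ρ (ρ m) ≡ m
    ρ-involutive-interior {m} i<m m<e with lo , hi ← ρ-stays i<m m<e = begin
      ρ (ρ m)             ≡⟨ ρ-interior S lo hi ⟩
      i + e ∸ ρ m         ≡⟨ cong (i + e ∸_) (ρ-interior S i<m m<e) ⟩
      i + e ∸ (i + e ∸ m) ≡⟨ m∸[m∸n]≡n (≤-trans (<⇒≤ m<e) (m≤n+m e i)) ⟩
      m                   ∎
      where open ≡-Reasoning

  ρ-involutive : ∀ {m} → m ≤ n → ρ (ρ m) ≡ m
  ρ-involutive {m} m≤n with lrMin? f m
  ... | yes min = ρ-min min
  ... | no ¬min with lo , hi , S ← strip-around ¬min m≤n =
    trans (cong ρ (sym (ρ-interior S lo hi))) (ρ-involutive-interior S lo hi)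

  -- A left-to-right minimum is never interior to a strip. The strip around `m` thus ends at or
  -- before `i`, and the reflection does not leave it. For the same reason no position crosses a
  -- minimum in `ρ-above`.
  ρ-below : ∀ {i m} → LRMin f i → i ≤ suc n → m < i → ρ m < i
  ρ-below {i} {m} min-i i≤1+n m<i with lrMin? f m
  ... | yes min = m<i
  ... | no ¬min with lo , hi , S ← strip-around ¬min (≤-pred (<-≤-trans m<i i≤1+n)) =
    subst (_< i) (ρ-interior S lo hi)
      (<-≤-trans (proj₂ (ρ-stays S lo hi)) (≮⇒≥ λ i<e → Strip.interior S (<-trans lo m<i) i<e min-i))

  ρ-above : ∀ {e m} → LRMin f e → e ≤ m → m ≤ n → e ≤ ρ m
  ρ-above {e} {m} min-e e≤m m≤n with lrMin? f m
  ... | yes min = e≤m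
  ... | no ¬min with lo , hi , S ← strip-around ¬min m≤n =
    subst (e ≤_) (ρ-interior S lo hi)
      (≤-trans (≮⇒≥ λ i<e → Strip.interior S i<e (≤-<-trans e≤m hi) min-e) (<⇒≤ (proj₁ (ρ-stays S lo hi))))

  ρ-inRange : ∀ {m} → InRange n m → InRange n (ρ m)
  -- Positions `1` and `n + 1` are both minima and act as barriers.
  ρ-inRange (1≤m , m≤n) = ρ-above lrMin-one 1≤m m≤n , ≤-pred (ρ-below lrMin-end ≤-refl (s≤s m≤n))

  smaller-before : ∀ {m} → ¬ LRMin f m → ∃[ k ] k < m × 1 ≤ k × f k ≤ f m
  smaller-before {m} ¬min with anyUpTo? (λ k → (1 ≤? k) ×-dec (f k ≤? f m)) m
  ... | yes found = found
  ... | no none   = contradiction (λ k k<m 1≤k → ≰⇒> λ le → none (k , k<m , 1≤k , le)) ¬min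

  -- Strong induction: an interior `m` is no minimum, so some earlier `k` has `f k ≤ f m`. If `k`
  -- lies before `i`, minimality of `i` bounds `f k`; otherwise the induction hypothesis does.
  strip-above : ∀ {i e} → Strip f n i e → ∀ m → i ≤ m → m < e → f i ≤ f m
  strip-above {i} {e} S = <-rec (λ m → i ≤ m → m < e → f i ≤ f m) step
    where
    open Strip S
    step : ∀ m → (∀ {k} → k < m → i ≤ k → k < e → f i ≤ f k) → i ≤ m → m < e → f i ≤ f m
    step m rec i≤m m<e with m≤n⇒m<n∨m≡n i≤m
    ... | inj₂ refl = ≤-refl
    ... | inj₁ i<m with k , k<m , 1≤k , le ← smaller-before (interior i<m m<e) with k <? i
    ...   | yes k<i = ≤-trans (<⇒≤ (minˡ k k<i 1≤k)) le
    ...   | no  k≮i = ≤-trans (rec k<m (≮⇒≥ k≮i) (<-trans k<m m<e)) le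

  -- `g` stands for the reversed word. The agreement extends to `n + 1`, where the last strip may
  -- end.
  module _ (g : ℕ → ℕ) (g≡ : ∀ {m} → 1 ≤ m → m ≤ suc n → g m ≡ f (ρ m)) where

    -- The value at `m` is unchanged, and the letters before `m` are letters of `f` at positions
    -- before `m`.
    ρ-preserves-lrMin : ∀ {m} → m ≤ suc n → LRMin f m → LRMin g m
    ρ-preserves-lrMin {m} m≤ min k k<m 1≤k = begin-strict
      g m     ≡⟨ g≡ (≤-trans 1≤k (<⇒≤ k<m)) m≤ ⟩
      f (ρ m) ≡⟨ cong f (ρ-min min) ⟩
      f m     <⟨ min (ρ k) (ρ-below min m≤ k<m) (ρ-above lrMin-one 1≤k (≤-pred (<-≤-trans k<m m≤))) ⟩
      f (ρ k) ≡⟨ g≡ 1≤k (≤-trans (<⇒≤ k<m) m≤) ⟨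
      g k     ∎
      where open ≤-Reasoning

    -- If `m` is interior to a strip of `f`, the left end of that strip keeps its value, which
    -- `strip-above` shows to be at most `g m`.
    ρ-reflects-lrMin : ∀ {m} → m ≤ suc n → LRMin g m → LRMin f m
    ρ-reflects-lrMin {m} m≤ min-g with lrMin? f m
    ... | yes min = min
    ... | no ¬min with m≤n ← ≤-pred (≤∧≢⇒< m≤ λ { refl → ¬min lrMin-end })
      with lo , hi , S ← strip-around ¬min m≤n = ⊥-elim (<⇒≱ (min-g i lo 1≤i) (begin
      g i     ≡⟨ g≡ 1≤i (≤-trans (<⇒≤ lo) m≤) ⟩
      f (ρ i) ≡⟨ cong f (ρ-min (Strip.minˡ S)) ⟩
      f i     ≤⟨ strip-above S (ρ m) (<⇒≤ (proj₁ stays)) (proj₂ stays) ⟩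
      f (ρ m) ≡⟨ g≡ (≤-trans 1≤i (<⇒≤ lo)) m≤ ⟨
      g m     ∎))
      where
      open ≤-Reasoning
      i : ℕ
      i = stripStart f m
      stays : i < ρ m × ρ m < stripEnd f n m
      stays = ρ-stays S lo hi
      -- A strip starting at `0` and containing `m` would have the minimum `1` in its interior.
      1≤i : 1 ≤ i
      1≤i = n≢0⇒n>0 λ eq →
        Strip.interior S (subst (_< 1) (sym eq) z<s) (≤-<-trans (subst (_< m) eq lo) hi) lrMin-one

    strip-preserved : ∀ {i e} → Strip f n i e → i ≤ e → Strip g n i e
    strip-preserved S i≤e = record
      { minˡ     = ρ-preserves-lrMin (≤-trans i≤e e≤1+n) minˡ
      ; minʳ     = ρ-preserves-lrMin e≤1+n minʳ
      ; e≤1+n    = e≤1+n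
      ; interior = λ lo hi → interior lo hi ∘ ρ-reflects-lrMin (≤-trans (<⇒≤ hi) e≤1+n)
      }
      where open Strip S

-- Strip reversal as an involution on permutations

reverseStrips : ℕ → List ℕ → List ℕ
reverseStrips n π = map (nth π ∘ reflect (nth π) n) (range1 n)

module Reversal {n π} (perm : IsPermutation n π) where

  open IsPermutation perm public
  open StripReversal (nth π) n (proj₁ ∘ inRange) (nth-overflow {π} (≤-reflexive (cong suc length≡))) public

  σ : List ℕ
  σ = reverseStrips n π

  length-σ : length σ ≡ n
  length-σ = trans (length-map _ (range1 n)) (length-range1 n)

  nth-σ : ∀ {m} → InRange n m → nth σ m ≡ nth π (ρ m)
  nth-σ {m} r@(1≤m , m≤n) = trans
    (nth-map (nth π ∘ ρ) {range1 n} (1≤m , subst (m ≤_) (sym (length-range1 n)) m≤n))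
    (cong (nth π ∘ ρ) (nth-range1 r))

  -- Both sides are the default value 0 beyond the end of a word, since `ρ` fixes `n + 1`.
  nth-σ-end : nth σ (suc n) ≡ nth π (ρ (suc n))
  nth-σ-end = trans (nth-overflow {σ} (≤-reflexive (cong suc length-σ)))
    (sym (trans (cong (nth π) (ρ-min lrMin-end)) (nth-overflow {π} (≤-reflexive (cong suc length≡)))))

  nth-σ′ : ∀ {m} → 1 ≤ m → m ≤ suc n → nth σ m ≡ nth π (ρ m)
  nth-σ′ 1≤m m≤ with m≤n⇒m<n∨m≡n m≤
  ... | inj₁ (s≤s m≤n) = nth-σ (1≤m , m≤n)
  ... | inj₂ refl      = nth-σ-end

  nth-σ-ρ : ∀ {m} → InRange n m → nth σ (ρ m) ≡ nth π m
  nth-σ-ρ r@(_ , m≤n) = trans (nth-σ (ρ-inRange r)) (cong (nth π) (ρ-involutive m≤n))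

  σ-isPermutation : IsPermutation n σ
  σ-isPermutation = record
    { length≡  = length-σ
    ; bounded  = λ q → let _ , r , eq = ∈-map⁻ _ q in
        subst (_∈ range1 n) (sym eq) (∈-range1⁺ (inRange (ρ-inRange (∈-range1⁻ r))))
    ; complete = λ q → let m , (1≤m , m≤) , eq = ∈-nth (complete q)
                           r = 1≤m , subst (m ≤_) length≡ m≤
                           1≤ρm , ρm≤n = ρ-inRange r in
        subst (_∈ σ) (trans (nth-σ-ρ r) eq) (nth-∈ {σ} (1≤ρm , subst (ρ m ≤_) (sym length-σ) ρm≤n))
    }

-- The reversed word has the same minima and hence the same strips, so the second reversal uses the
-- same reflection `ρ`, which is an involution.
reverseStrips-involutive : ∀ {n π} → IsPermutation n π → reverseStrips n (reverseStrips n π) ≡ π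
reverseStrips-involutive {n} {π} perm = nth-ext (trans Rσ.length-σ (sym Rπ.length≡)) λ {m} (1≤m , m≤) →
  let r@(_ , m≤n) = 1≤m , subst (m ≤_) Rσ.length-σ m≤ in begin
    nth (reverseStrips n Rπ.σ) m ≡⟨ Rσ.nth-σ r ⟩
    nth Rπ.σ (Rσ.ρ m)            ≡⟨ cong (nth Rπ.σ) (same-ρ m≤n) ⟩
    nth Rπ.σ (Rπ.ρ m)            ≡⟨ Rπ.nth-σ-ρ r ⟩
    nth π m                      ∎
  where
  open ≡-Reasoning
  module Rπ = Reversal perm
  module Rσ = Reversal Rπ.σ-isPermutation
  same-ρ : ∀ {m} → m ≤ n → Rσ.ρ m ≡ Rπ.ρ m
  same-ρ {m} m≤n with lrMin? (nth π) m
  ... | yes min = Rσ.ρ-min (Rπ.ρ-preserves-lrMin (nth Rπ.σ) Rπ.nth-σ′ (m≤n⇒m≤1+n m≤n) min)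
  ... | no ¬min with lo , hi , S ← Rπ.strip-around ¬min m≤n =
    Rσ.ρ-interior (Rπ.strip-preserved (nth Rπ.σ) Rπ.nth-σ′ S (<⇒≤ (<-trans lo hi))) lo hi

-- Occurrences of mesh patterns

-- `cols` and `rows` are the grid lines including both boundaries. Boxes count from 0 and `nth` from
-- 1, hence the shift by `suc`.
Clear : ℕ → (ℕ → ℕ) → List ℕ → List ℕ → ℕ × ℕ → Set
Clear n f cols rows (a , b) = ∀ {m} → InRange n m →
  nth cols (suc a) < m → m < nth cols (suc (suc a)) →
  nth rows (suc b) < f m → f m < nth rows (suc (suc b)) → ⊥

-- The emptiness test inside `isOccᵇ`, with the grid lines as arguments so that the sorted values
-- can be replaced by explicit ones.
clearᵇ : ℕ → (ℕ → ℕ) → List ℕ → List ℕ → ℕ × ℕ → Bool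
clearᵇ n f cols rows (a , b) = not (any (λ m →
  (nth cols (suc a) <ᵇ m) ∧ (m <ᵇ nth cols (suc (suc a))) ∧
  (nth rows (suc b) <ᵇ f m) ∧ (f m <ᵇ nth rows (suc (suc b)))) (range1 n))

T-not⁻ : ∀ {b} → T (not b) → ¬ T b
T-not⁻ {false} _ ()

T-not⁺ : ∀ {b} → ¬ T b → T (not b)
T-not⁺ {false} _ = tt
T-not⁺ {true} ¬t = ¬t tt

T-∧⁺ : ∀ {a b} → T a → T b → T (a ∧ b)
T-∧⁺ ta tb = Equivalence.from T-∧ (ta , tb)

T-∧⁻ : ∀ {a b} → T (a ∧ b) → T a × T b
T-∧⁻ = Equivalence.to T-∧

clearᵇ⁻ : ∀ {n f cols rows} p → T (clearᵇ n f cols rows p) → Clear n f cols rows p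
clearᵇ⁻ p t r c₁ c₂ r₁ r₂ = T-not⁻ t (any⁺ _ (lose (∈-range1⁺ r)
  (T-∧⁺ (<⇒<ᵇ c₁) (T-∧⁺ (<⇒<ᵇ c₂) (T-∧⁺ (<⇒<ᵇ r₁) (<⇒<ᵇ r₂))))))

clearᵇ⁺ : ∀ {n f cols rows} p → Clear n f cols rows p → T (clearᵇ n f cols rows p)
clearᵇ⁺ {n} {f} {cols} {rows} (a , b) clear = T-not⁺ λ t →
  let m , m∈ , t₀ = find (any⁻ _ (range1 n) t)
      c₁ , t₁ = T-∧⁻ {nth cols (suc a) <ᵇ m} t₀
      c₂ , t₂ = T-∧⁻ {m <ᵇ nth cols (suc (suc a))} t₁
      r₁ , r₂ = T-∧⁻ {nth rows (suc b) <ᵇ f m} t₂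
  in clear (∈-range1⁻ m∈) (<ᵇ⇒< _ _ c₁) (<ᵇ⇒< _ _ c₂) (<ᵇ⇒< _ _ r₁) (<ᵇ⇒< _ _ r₂)

-- Sorting three letters and recognising 123 and 132

insert-≤ : ∀ {x y ys} → x ≤ y → insert x (y ∷ ys) ≡ x ∷ y ∷ ys
insert-≤ {x} {y} x≤y with true ← x ≤ᵇ y | _ ← ≤⇒≤ᵇ x≤y = refl

insert-> : ∀ {x y ys} → y < x → insert x (y ∷ ys) ≡ y ∷ insert x ys
insert-> {x} {y} y<x with x ≤ᵇ y in eq
... | false = refl
... | true  = contradiction (≤ᵇ⇒≤ x y (subst T (sym eq) tt)) (<⇒≱ y<x)

boolEq-true⁻ : ∀ {a b} → T (boolEq (a <ᵇ b) true) → a < b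
boolEq-true⁻ {a} {b} t with a <ᵇ b in eq
... | true = <ᵇ⇒< a b (subst T (sym eq) tt)

boolEq-true⁺ : ∀ {a b} → a < b → T (boolEq (a <ᵇ b) true)
boolEq-true⁺ {a} {b} lt with true ← a <ᵇ b | _ ← <⇒<ᵇ lt = tt

boolEq-false⁺ : ∀ {a b} → b ≤ a → T (boolEq (a <ᵇ b) false)
boolEq-false⁺ {a} {b} le with a <ᵇ b in eq
... | false = tt
... | true  = contradiction (<ᵇ⇒< a b (subst T (sym eq) tt)) (≤⇒≯ le)

data Shape : Set where
  inc dec : Shape

flip : Shape → Shape
flip inc = dec
flip dec = inc

pattern₃ : Shape → List ℕ
pattern₃ inc = 1 ∷ 2 ∷ 3 ∷ []
pattern₃ dec = 1 ∷ 3 ∷ 2 ∷ []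

-- Both patterns start with their smallest letter, so the shape only decides which of the last two
-- letters is the middle value.
Arranged : Shape → ℕ → ℕ → ℕ → ℕ → Set
Arranged inc y z v₂ v₃ = y ≡ v₂ × z ≡ v₃
Arranged dec y z v₂ v₃ = y ≡ v₃ × z ≡ v₂

Arranged-flip : ∀ s {y z v₂ v₃} → Arranged s y z v₂ v₃ → Arranged (flip s) z y v₂ v₃
Arranged-flip inc (p , q) = q , p
Arranged-flip dec (p , q) = q , p

record Sorted₃ (s : Shape) (x y z v₁ v₂ v₃ : ℕ) : Set where
  field
    first    : x ≡ v₁
    arranged : Arranged s y z v₂ v₃
    v₁<v₂    : v₁ < v₂
    v₂<v₃    : v₂ < v₃

sort₃ : ∀ s {x y z v₁ v₂ v₃} → Sorted₃ s x y z v₁ v₂ v₃ → sortℕ (x ∷ y ∷ z ∷ []) ≡ v₁ ∷ v₂ ∷ v₃ ∷ []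
sort₃ inc record { first = refl ; arranged = refl , refl ; v₁<v₂ = lt ; v₂<v₃ = lt′ }
  rewrite insert-≤ {ys = []} (<⇒≤ lt′) = insert-≤ (<⇒≤ lt)
sort₃ dec record { first = refl ; arranged = refl , refl ; v₁<v₂ = lt ; v₂<v₃ = lt′ }
  rewrite insert-> {ys = []} lt′ = insert-≤ (<⇒≤ lt)

sameOrderᵇ : List ℕ → List ℕ → ℕ × ℕ → Bool
sameOrderᵇ xs ys (a , b) = boolEq (nth xs a <ᵇ nth xs b) (nth ys a <ᵇ nth ys b)

-- The nine comparisons are listed in lexicographic order of index pairs. The pairs (1,2) and (2,3)
-- settle 123; the pairs (1,3) and (3,2) settle 132.
orderIso⁻ : ∀ s {x y z} → T (orderIsoᵇ (x ∷ y ∷ z ∷ []) (pattern₃ s)) → ∃₂ (Sorted₃ s x y z x)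
orderIso⁻ inc {x} {y} {z} t
  with _ ∷ xy ∷ _ ∷ _ ∷ _ ∷ yz ∷ _ ← all⁺ (sameOrderᵇ (x ∷ y ∷ z ∷ []) (pattern₃ inc)) (allPairs (x ∷ y ∷ z ∷ [])) t =
  y , z , record { first = refl ; arranged = refl , refl ; v₁<v₂ = boolEq-true⁻ {x} xy ; v₂<v₃ = boolEq-true⁻ {y} yz }
orderIso⁻ dec {x} {y} {z} t
  with _ ∷ _ ∷ xz ∷ _ ∷ _ ∷ _ ∷ _ ∷ zy ∷ _ ← all⁺ (sameOrderᵇ (x ∷ y ∷ z ∷ []) (pattern₃ dec)) (allPairs (x ∷ y ∷ z ∷ [])) t =
  z , y , record { first = refl ; arranged = refl , refl ; v₁<v₂ = boolEq-true⁻ {x} xz ; v₂<v₃ = boolEq-true⁻ {z} zy }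

orderIso⁺ : ∀ s {x y z v₁ v₂ v₃} → Sorted₃ s x y z v₁ v₂ v₃ → T (orderIsoᵇ (x ∷ y ∷ z ∷ []) (pattern₃ s))
orderIso⁺ inc {x} {y} {z} record { first = refl ; arranged = refl , refl ; v₁<v₂ = xy ; v₂<v₃ = yz } =
  all⁻ (sameOrderᵇ (x ∷ y ∷ z ∷ []) (pattern₃ inc)) {allPairs (x ∷ y ∷ z ∷ [])}
    ( boolEq-false⁺ {x} ≤-refl ∷ boolEq-true⁺ xy ∷ boolEq-true⁺ (<-trans xy yz)
    ∷ boolEq-false⁺ (<⇒≤ xy) ∷ boolEq-false⁺ {y} ≤-refl ∷ boolEq-true⁺ yz
    ∷ boolEq-false⁺ (<⇒≤ (<-trans xy yz)) ∷ boolEq-false⁺ (<⇒≤ yz) ∷ boolEq-false⁺ {z} ≤-refl ∷ [])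
orderIso⁺ dec {x} {y} {z} record { first = refl ; arranged = refl , refl ; v₁<v₂ = xz ; v₂<v₃ = zy } =
  all⁻ (sameOrderᵇ (x ∷ y ∷ z ∷ []) (pattern₃ dec)) {allPairs (x ∷ y ∷ z ∷ [])}
    ( boolEq-false⁺ {x} ≤-refl ∷ boolEq-true⁺ (<-trans xz zy) ∷ boolEq-true⁺ xz
    ∷ boolEq-false⁺ (<⇒≤ (<-trans xz zy)) ∷ boolEq-false⁺ {y} ≤-refl ∷ boolEq-false⁺ (<⇒≤ zy)
    ∷ boolEq-false⁺ (<⇒≤ xz) ∷ boolEq-true⁺ zy ∷ boolEq-false⁺ {z} ≤-refl ∷ [])

record Occurrence (s : Shape) (R : List (ℕ × ℕ)) (n : ℕ) (f : ℕ → ℕ) (i j k : ℕ) : Set where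
  field
    {v₁ v₂ v₃} : ℕ
    sorted     : Sorted₃ s (f i) (f j) (f k) v₁ v₂ v₃
    clear      : All (Clear n f (0 ∷ i ∷ j ∷ k ∷ suc n ∷ []) (0 ∷ v₁ ∷ v₂ ∷ v₃ ∷ suc n ∷ [])) R
  open Sorted₃ sorted public

module _ (s : Shape) {R : List (ℕ × ℕ)} {n : ℕ} {π : List ℕ} {i j k : ℕ} where

  private
    clear₃ᵇ : List ℕ → ℕ × ℕ → Bool
    clear₃ᵇ vs = clearᵇ n (nth π) (0 ∷ i ∷ j ∷ k ∷ suc n ∷ []) (0 ∷ (vs ++ suc n ∷ []))

  occurrence⁻ : T (isOccᵇ n π (pattern₃ s , R) (i ∷ j ∷ k ∷ [])) → Occurrence s R n (nth π) i j k
  occurrence⁻ t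
    with iso , boxes ← T-∧⁻ {orderIsoᵇ (map (nth π) (i ∷ j ∷ k ∷ [])) (pattern₃ s)} t
    with v₂ , v₃ , sorted ← orderIso⁻ s {nth π i} {nth π j} {nth π k} iso = record
    { sorted = sorted
    ; clear  = All.map (λ {p} → clearᵇ⁻ {cols = 0 ∷ i ∷ j ∷ k ∷ suc n ∷ []} {0 ∷ nth π i ∷ v₂ ∷ v₃ ∷ suc n ∷ []} p)
        (all⁺ (clear₃ᵇ (nth π i ∷ v₂ ∷ v₃ ∷ [])) R
          (subst (λ vs → T (all (clear₃ᵇ vs) R)) (sort₃ s sorted) boxes))
    }

  occurrence⁺ : Occurrence s R n (nth π) i j k → T (isOccᵇ n π (pattern₃ s , R) (i ∷ j ∷ k ∷ []))
  occurrence⁺ occ = T-∧⁺ (orderIso⁺ s sorted)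
    (subst (λ vs → T (all (clear₃ᵇ vs) R)) (sym (sort₃ s sorted))
      (all⁻ (clear₃ᵇ (v₁ ∷ v₂ ∷ v₃ ∷ []))
        (All.map (λ {p} → clearᵇ⁺ {n} {nth π} {0 ∷ i ∷ j ∷ k ∷ suc n ∷ []} {0 ∷ v₁ ∷ v₂ ∷ v₃ ∷ suc n ∷ []} p) clear)))
    where open Occurrence occ

-- Reversing the strips exchanges the two patterns

corner : List (ℕ × ℕ)
corner = (0 , 0) ∷ (0 , 1) ∷ (0 , 2) ∷ (1 , 0) ∷ (2 , 0) ∷ []

-- Column 3 also contains the letters after the strip, which do not move to column 1; hence both
-- mirror images must be shaded.
Mirrored : List (ℕ × ℕ) → ℕ × ℕ → Set
Mirrored R (a , b) = 1 ≤ a × a ≤ 3 × (4 ∸ a , b) ∈ R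

Reversible : List (ℕ × ℕ) → Set
Reversible R = All (_∈ R) corner × All (λ p → p ∈ corner ⊎ Mirrored R p) R

open DecMembership (≡-dec _≟_ _≟_) using (_∈?_)

reversible? : ∀ R → Dec (Reversible R)
reversible? R = All.all? (_∈? R) corner ×-dec
  All.all? (λ p → (p ∈? corner) ⊎-dec ((1 ≤? proj₁ p) ×-dec (proj₁ p ≤? 3) ×-dec ((4 ∸ proj₁ p , proj₂ p) ∈? R))) R

module Transfer {R} (reversible : Reversible R) (s : Shape) {n π} (perm : IsPermutation n π)
  {i j k} (1≤i : 1 ≤ i) (i<j : i < j) (j<k : j < k) (k≤n : k ≤ n)
  (occ : Occurrence s R n (nth π) i j k) where

  open Reversal perm
  open Occurrence occ

  private
    f : ℕ → ℕ
    f = nth π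

    rows : List ℕ
    rows = 0 ∷ v₁ ∷ v₂ ∷ v₃ ∷ suc n ∷ []

    v₁<v₃ : v₁ < v₃
    v₁<v₃ = <-trans v₁<v₂ v₂<v₃

    i<k : i < k
    i<k = <-trans i<j j<k

    j∈ : InRange n j
    j∈ = ≤-trans 1≤i (<⇒≤ i<j) , ≤-trans (<⇒≤ j<k) k≤n

    k∈ : InRange n k
    k∈ = ≤-trans 1≤i (<⇒≤ i<k) , k≤n

    i∈ : InRange n i
    i∈ = 1≤i , ≤-trans (<⇒≤ i<k) k≤n

    clear-at : ∀ {p} → p ∈ R → Clear n f (0 ∷ i ∷ j ∷ k ∷ suc n ∷ []) rows p
    clear-at = All.lookup clear

    corner-clear : ∀ {p} → p ∈ corner → Clear n f (0 ∷ i ∷ j ∷ k ∷ suc n ∷ []) rows p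
    corner-clear = clear-at ∘ All.lookup (proj₁ reversible)

    v₁<fj×v₁<fk : ∀ s → Arranged s (f j) (f k) v₂ v₃ → v₁ < f j × v₁ < f k
    v₁<fj×v₁<fk inc (refl , refl) = v₁<v₂ , v₁<v₃
    v₁<fj×v₁<fk dec (refl , refl) = v₁<v₃ , v₁<v₂

    -- The values `v₂` and `v₃` are taken after `i`, so by injectivity no letter before `i` has
    -- them.
    witnesses : ∀ s → Arranged s (f j) (f k) v₂ v₃ →
      (∃[ p ] i < p × InRange n p × f p ≡ v₂) × (∃[ p ] i < p × InRange n p × f p ≡ v₃)
    witnesses inc (p , q) = (j , i<j , j∈ , p) , (k , i<k , k∈ , q)
    witnesses dec (p , q) = (k , i<k , k∈ , q) , (j , i<j , j∈ , p)

    -- The shaded boxes of column 0 exclude the open ranges below `v₃`, and injectivity excludes the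
    -- values `v₁`, `v₂`, `v₃` themselves.
    before-high : ∀ {m} → InRange n m → m < i → v₃ < f m
    before-high {m} r@(1≤m , m≤n) m<i with <-cmp (f m) v₁ | <-cmp (f m) v₂ | <-cmp (f m) v₃
    ... | tri< lt _ _ | _ | _ = ⊥-elim (corner-clear (here refl) r 1≤m m<i (proj₁ (inRange r)) lt)
    ... | tri≈ _ eq _ | _ | _ =
      contradiction (nth-injective r i∈ (trans eq (sym first))) (<⇒≢ m<i)
    ... | tri> _ _ gt | tri< lt _ _ | _ = ⊥-elim (corner-clear (there (here refl)) r 1≤m m<i gt lt)
    ... | tri> _ _ _ | tri≈ _ eq _ | _ with (p , i<p , p∈ , eq′) , _ ← witnesses s arranged =
      contradiction (nth-injective r p∈ (trans eq (sym eq′))) (<⇒≢ (<-trans m<i i<p))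
    ... | tri> _ _ _ | tri> _ _ gt | tri< lt _ _ =
      ⊥-elim (corner-clear (there (there (here refl))) r 1≤m m<i gt lt)
    ... | tri> _ _ _ | tri> _ _ _ | tri≈ _ eq _ with _ , (p , i<p , p∈ , eq′) ← witnesses s arranged =
      contradiction (nth-injective r p∈ (trans eq (sym eq′))) (<⇒≢ (<-trans m<i i<p))
    ... | tri> _ _ _ | tri> _ _ _ | tri> _ _ gt = gt

    min-i : LRMin f i
    min-i m m<i 1≤m = subst (_< f m) (sym first)
      (<-trans v₁<v₃ (before-high (1≤m , ≤-trans (<⇒≤ m<i) (proj₂ i∈)) m<i))

    -- Boxes (1,0) and (2,0) exclude low letters between the chosen positions; the letters at `j`
    -- and `k` exceed `v₁` anyway.
    after-not-low : ∀ {m} → i < m → m ≤ k → ¬ f m < v₁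
    after-not-low {m} i<m m≤k low
      with r ← ≤-trans 1≤i (<⇒≤ i<m) , ≤-trans m≤k k≤n | fj , fk ← v₁<fj×v₁<fk s arranged | <-cmp m j
    ... | tri< m<j _ _  = corner-clear (there (there (there (here refl)))) r i<m m<j (proj₁ (inRange r)) low
    ... | tri≈ _ refl _ = <-asym fj low
    ... | tri> _ _ j<m with m≤n⇒m<n∨m≡n m≤k
    ...   | inj₁ m<k  = corner-clear (there (there (there (there (here refl))))) r j<m m<k (proj₁ (inRange r)) low
    ...   | inj₂ refl = <-asym fk low

    e : ℕ
    e = stripEnd f n k

    k<e×strip : k < e × Strip f n i e
    -- A minimum after `i` and up to `k` would have a value below `f i`, that is, below `v₁`.
    k<e×strip = extend-strip min-i (<⇒≤ i<k) k≤n λ {m} i<m m≤k min →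
      after-not-low i<m m≤k (subst (f m <_) first (min i i<m 1≤i))

    k<e : k < e
    k<e = proj₁ k<e×strip

    S : Strip f n i e
    S = proj₂ k<e×strip

    j<e : j < e
    j<e = <-trans j<k k<e

    ρρj : ρ (ρ j) ≡ j
    ρρj = ρ-involutive (proj₂ j∈)

    ρρk : ρ (ρ k) ≡ k
    ρρk = ρ-involutive k≤n

  i<ρk : i < ρ k
  i<ρk = proj₁ (ρ-stays S i<k k<e)

  ρk<ρj : ρ k < ρ j
  ρk<ρj = ρ-reverses S i<j j<k k<e

  private
    ρj<e : ρ j < e
    ρj<e = proj₂ (ρ-stays S i<j j<e)

    Clear-σ : ℕ × ℕ → Set
    Clear-σ = Clear n (nth σ) (0 ∷ i ∷ ρ k ∷ ρ j ∷ suc n ∷ []) rows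

    before-high-σ : ∀ {m} → InRange n m → m < i → v₃ < nth σ m
    before-high-σ r m<i = subst (v₃ <_) (sym (nth-σ r))
      (before-high (ρ-inRange r) (ρ-below min-i (m≤n⇒m≤1+n (proj₂ i∈)) m<i))

    strip-not-low-σ : ∀ {m} → InRange n m → i < m → m < e → ¬ nth σ m < v₁
    strip-not-low-σ {m} r i<m m<e with lo , hi ← ρ-stays S i<m m<e = ≤⇒≯
      (subst₂ _≤_ first (sym (nth-σ r)) (strip-above S (ρ m) (<⇒≤ lo) hi))

    -- Column 0 stays clear because `ρ` maps the positions before `i` among themselves. The bottom
    -- boxes stay clear because they lie over the strip, whose letters are all at least `v₁`.
    corner-clear-σ : ∀ {p} → p ∈ corner → Clear-σ p
    corner-clear-σ (here refl) r _ m<i _ lt = <-asym (before-high-σ r m<i) (<-trans lt v₁<v₃)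
    corner-clear-σ (there (here refl)) r _ m<i _ lt = <-asym (before-high-σ r m<i) (<-trans lt v₂<v₃)
    corner-clear-σ (there (there (here refl))) r _ m<i _ lt = <-asym (before-high-σ r m<i) lt
    corner-clear-σ (there (there (there (here refl)))) r i<m m<ρk _ lt =
      strip-not-low-σ r i<m (<-trans m<ρk (<-trans ρk<ρj ρj<e)) lt
    corner-clear-σ (there (there (there (there (here refl))))) r ρk<m m<ρj _ lt =
      strip-not-low-σ r (<-trans i<ρk ρk<m) (<-trans m<ρj ρj<e) lt

    -- A letter of the new word in a shaded box is traced back along `ρ`: from column 1 it comes
    -- from column 3 of the old word, from column 2 it comes from column 2, and from column 3 it
    -- comes from column 1 if it lies in the strip.
    mirrored-clear-σ : ∀ {p} → p ∈ R → Mirrored R p → Clear-σ p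
    mirrored-clear-σ {suc zero , b} _ (_ , _ , mirror) {m} r i<m m<ρk lo hi
      rewrite nth-σ r = clear-at mirror (ρ-inRange r)
        (subst (_< ρ m) ρρk (ρ-reverses S i<m m<ρk (<-trans ρk<ρj ρj<e)))
        (s≤s (proj₂ (ρ-inRange r))) lo hi
    mirrored-clear-σ {suc (suc zero) , b} p∈R _ {m} r ρk<m m<ρj lo hi
      rewrite nth-σ r = clear-at p∈R (ρ-inRange r)
        (subst (_< ρ m) ρρj (ρ-reverses S (<-trans i<ρk ρk<m) m<ρj ρj<e))
        (subst (ρ m <_) ρρk (ρ-reverses S i<ρk ρk<m (<-trans m<ρj ρj<e))) lo hi
    mirrored-clear-σ {suc (suc (suc zero)) , b} p∈R (_ , _ , mirror) {m} r ρj<m _ lo hi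
      rewrite nth-σ r with m <? e
    ... | yes m<e = clear-at mirror (ρ-inRange r)
      (proj₁ (ρ-stays S (<-trans (<-trans i<ρk ρk<ρj) ρj<m) m<e))
      (subst (ρ m <_) ρρj (ρ-reverses S (<-trans i<ρk ρk<ρj) ρj<m m<e)) lo hi
    -- At or beyond `e` the letter comes from a position at or beyond `e`, which was already in
    -- column 3.
    ... | no m≮e = clear-at p∈R (ρ-inRange r)
      (<-≤-trans k<e (ρ-above (Strip.minʳ S) (≮⇒≥ m≮e) (proj₂ r)))
      (s≤s (proj₂ (ρ-inRange r))) lo hi
    mirrored-clear-σ {zero , b} _ (() , _)
    mirrored-clear-σ {suc (suc (suc (suc a))) , b} _ (_ , s≤s (s≤s (s≤s ())) , _)

    clear-σ : ∀ {p} → p ∈ R → Clear-σ p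
    clear-σ p∈R with All.lookup (proj₂ reversible) p∈R
    ... | inj₁ c = corner-clear-σ c
    ... | inj₂ m = mirrored-clear-σ p∈R m

  ρj≤n : ρ j ≤ n
  ρj≤n = proj₂ (ρ-inRange j∈)

  -- The same three letters are chosen, the last two in exchanged order, so the row lines `v₁`,
  -- `v₂`, `v₃` are unchanged.
  reversed-occurrence : Occurrence (flip s) R n (nth σ) i (ρ k) (ρ j)
  reversed-occurrence = record
    { sorted = record
        { first    = trans (nth-σ i∈) (trans (cong f (ρ-min min-i)) first)
        ; arranged = subst₂ (λ y z → Arranged (flip s) y z v₂ v₃) (sym (nth-σ-ρ k∈)) (sym (nth-σ-ρ j∈))
            (Arranged-flip s arranged)
        ; v₁<v₂    = v₁<v₂
        ; v₂<v₃    = v₂<v₃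
        }
    ; clear = All.tabulate clear-σ
    }

-- Comparing the numbers of occurrences and of permutations

∈-triples⁻ : ∀ {n is} → is ∈ choose 3 (range1 n) →
  ∃[ i ] ∃[ j ] ∃[ k ] is ≡ i ∷ j ∷ k ∷ [] × 1 ≤ i × i < j × j < k × k ≤ n
∈-triples⁻ {n} {is} q with ∈-choose⁻ 3 {range1 n} q | choose-sorted 3 (range1-sorted n) q
∈-triples⁻ {n} {i ∷ j ∷ k ∷ []} q | _ , sub | (i<j ∷ _) ∷ (j<k ∷ []) ∷ _ =
  i , j , k , refl , proj₁ (∈-range1⁻ (sub (here refl))) , i<j , j<k ,
  proj₂ (∈-range1⁻ (sub (there (there (here refl)))))

∈-triples⁺ : ∀ {n i j k} → 1 ≤ i → i < j → j < k → k ≤ n → i ∷ j ∷ k ∷ [] ∈ choose 3 (range1 n)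
∈-triples⁺ {n} {i} {j} {k} 1≤i i<j j<k k≤n = ∈-choose⁺ {range1 n} (range1-sorted n)
  ((i<j ∷ <-trans i<j j<k ∷ []) ∷ (j<k ∷ []) ∷ [] ∷ [])
  λ { (here refl)                 → ∈-range1⁺ (1≤i , <⇒≤ (<-≤-trans (<-trans i<j j<k) k≤n))
    ; (there (here refl))         → ∈-range1⁺ (<⇒≤ (≤-<-trans 1≤i i<j) , <⇒≤ (<-≤-trans j<k k≤n))
    ; (there (there (here refl))) → ∈-range1⁺ (<⇒≤ (≤-<-trans 1≤i (<-trans i<j j<k)) , k≤n) }

module _ {R} (reversible : Reversible R) where

  occurrences-≤ : ∀ s {n π} → IsPermutation n π →
    occurrences n (pattern₃ s , R) π ≤ occurrences n (pattern₃ (flip s) , R) (reverseStrips n π)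
  occurrences-≤ s {n} {π} perm = subst₂ _≤_ (unfold s π) (unfold (flip s) σ)
    (length-≤-injection image
      (filterᵇ-unique (isOccᵇ n π (pattern₃ s , R)) (choose-unique 3 (range1-unique n))) into injective)
    where
    open Reversal perm

    occs : Shape → List ℕ → List (List ℕ)
    occs s′ π′ = filterᵇ (isOccᵇ n π′ (pattern₃ s′ , R)) (choose 3 (range1 n))

    -- The length of `pattern₃ s′` reduces to 3 only once the shape is known.
    unfold : ∀ s′ π′ → length (occs s′ π′) ≡ occurrences n (pattern₃ s′ , R) π′
    unfold inc π′ = refl
    unfold dec π′ = refl

    image : List ℕ → List ℕ
    image (i ∷ j ∷ k ∷ []) = i ∷ ρ k ∷ ρ j ∷ []
    image is               = is

    into : ∀ {is} → is ∈ occs s π → image is ∈ occs (flip s) σ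
    into q with r , t ← ∈-filterᵇ⁻ (isOccᵇ n π (pattern₃ s , R)) (choose 3 (range1 n)) q
      with i , j , k , refl , 1≤i , i<j , j<k , k≤n ← ∈-triples⁻ {n} r =
      ∈-filterᵇ⁺ (isOccᵇ n σ (pattern₃ (flip s) , R))
        (∈-triples⁺ {n} 1≤i Tr.i<ρk Tr.ρk<ρj Tr.ρj≤n) (occurrence⁺ (flip s) {R} {n} {σ} Tr.reversed-occurrence)
      where module Tr = Transfer reversible s perm 1≤i i<j j<k k≤n (occurrence⁻ s {R} {n} {π} t)

    ρ-injective : ∀ {p q} → p ≤ n → q ≤ n → ρ p ≡ ρ q → p ≡ q
    ρ-injective p≤n q≤n eq = trans (sym (ρ-involutive p≤n)) (trans (cong ρ eq) (ρ-involutive q≤n))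

    injective : ∀ {is is′} → is ∈ occs s π → is′ ∈ occs s π → image is ≡ image is′ → is ≡ is′
    injective p q eq
      with _ , _ , _ , refl , _ , _ , j<k , k≤n ←
        ∈-triples⁻ {n} (proj₁ (∈-filterᵇ⁻ (isOccᵇ n π (pattern₃ s , R)) (choose 3 (range1 n)) p))
      with _ , _ , _ , refl , _ , _ , j<k′ , k≤n′ ←
        ∈-triples⁻ {n} (proj₁ (∈-filterᵇ⁻ (isOccᵇ n π (pattern₃ s , R)) (choose 3 (range1 n)) q))
      with refl , eq′ ← ∷-injective eq
      with eqk , eq″ ← ∷-injective eq′ =
      cong₂ (λ j k → _ ∷ j ∷ k ∷ [])
        (ρ-injective (<⇒≤ (<-≤-trans j<k k≤n)) (<⇒≤ (<-≤-trans j<k′ k≤n′)) (∷-injectiveˡ eq″))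
        (ρ-injective k≤n k≤n′ eqk)

  flip-flip : ∀ s → flip (flip s) ≡ s
  flip-flip inc = refl
  flip-flip dec = refl

  -- The inequality `occurrences-≤` is applied to `π` and to its reversal; as flipping and reversing
  -- are involutions, the second application gives the converse bound.
  occurrences-reverseStrips : ∀ s {n π} → IsPermutation n π →
    occurrences n (pattern₃ (flip s) , R) (reverseStrips n π) ≡ occurrences n (pattern₃ s , R) π
  occurrences-reverseStrips s {n} {π} perm = ≤-antisym
    (subst₂ (λ s′ π′ → occurrences n (pattern₃ (flip s) , R) (reverseStrips n π) ≤ occurrences n (pattern₃ s′ , R) π′)
      (flip-flip s) (reverseStrips-involutive perm) (occurrences-≤ (flip s) (Reversal.σ-isPermutation perm)))
    (occurrences-≤ s perm)

  -- Strip reversal is injective on permutations, being an involution. The two shapes give the two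
  -- inequalities of the equidistribution.
  countWith-≤ : ∀ s n ℓ → countWith (pattern₃ s , R) n ℓ ≤ countWith (pattern₃ (flip s) , R) n ℓ
  countWith-≤ s n ℓ = length-≤-injection (reverseStrips n) (filterᵇ-unique (hits s) (perms-unique n)) into injective
    where
    hits : Shape → List ℕ → Bool
    hits s′ π = occurrences n (pattern₃ s′ , R) π ≡ᵇ ℓ

    permutation : ∀ {π} → π ∈ filterᵇ (hits s) (perms n) → IsPermutation n π
    permutation = ∈-perms⁻ ∘ proj₁ ∘ ∈-filterᵇ⁻ (hits s) (perms n)

    into : ∀ {π} → π ∈ filterᵇ (hits s) (perms n) → reverseStrips n π ∈ filterᵇ (hits (flip s)) (perms n)
    into q = ∈-filterᵇ⁺ (hits (flip s)) (∈-perms⁺ (Reversal.σ-isPermutation perm))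
      (subst (λ c → T (c ≡ᵇ ℓ)) (sym (occurrences-reverseStrips s perm))
        (proj₂ (∈-filterᵇ⁻ (hits s) (perms n) q)))
      where perm = permutation q

    injective : ∀ {π π′} → π ∈ filterᵇ (hits s) (perms n) → π′ ∈ filterᵇ (hits s) (perms n) →
      reverseStrips n π ≡ reverseStrips n π′ → π ≡ π′
    injective p q eq = trans (sym (reverseStrips-involutive (permutation p)))
      (trans (cong (reverseStrips n) eq) (reverseStrips-involutive (permutation q)))

-- For a concrete `R` the implicit argument is found by evaluating `reversible?`, which checks the
-- symmetry of the shading.
123∼d132 : ∀ R {_ : True (reversible? R)} → (1 ∷ 2 ∷ 3 ∷ [] , R) ∼d (1 ∷ 3 ∷ 2 ∷ [] , R)
123∼d132 R {ok} n ℓ = ≤-antisym (countWith-≤ reversible inc n ℓ) (countWith-≤ reversible dec n ℓ)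
  where reversible = toWitness ok

theorem3p2 :
  let
    p123 = 1 ∷ 2 ∷ 3 ∷ []
    p132 = 1 ∷ 3 ∷ 2 ∷ []
    R1 = (0 , 0) ∷ (0 , 1) ∷ (0 , 2) ∷ (1 , 0) ∷ (2 , 0) ∷ (2 , 2) ∷ []
    R2 = (0 , 0) ∷ (0 , 1) ∷ (0 , 2) ∷ (1 , 0) ∷ (1 , 2) ∷ (2 , 0) ∷ (2 , 1) ∷ (2 , 3) ∷ (3 , 2) ∷ []
    R3 = (0 , 0) ∷ (0 , 1) ∷ (0 , 2) ∷ (1 , 0) ∷ (1 , 1) ∷ (1 , 3) ∷ (2 , 0) ∷ (3 , 1) ∷ (3 , 3) ∷ []
    R4 = (0 , 0) ∷ (0 , 1) ∷ (0 , 2) ∷ (1 , 0) ∷ (1 , 1) ∷ (1 , 3) ∷ (2 , 0) ∷ (2 , 2) ∷ (3 , 1) ∷ (3 , 3) ∷ []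
    R5 = (0 , 0) ∷ (0 , 1) ∷ (0 , 2) ∷ (1 , 0) ∷ (1 , 2) ∷ (2 , 0) ∷ (2 , 1) ∷ (2 , 2) ∷ (2 , 3) ∷ (3 , 2) ∷ []
    R6 = (0 , 0) ∷ (0 , 1) ∷ (0 , 2) ∷ (1 , 0) ∷ (1 , 1) ∷ (1 , 2) ∷ (1 , 3) ∷ (2 , 0) ∷ (2 , 1) ∷ (2 , 3) ∷ (3 , 1) ∷ (3 , 2) ∷ (3 , 3) ∷ []
    R7 = (0 , 0) ∷ (0 , 1) ∷ (0 , 2) ∷ (1 , 0) ∷ (1 , 1) ∷ (1 , 2) ∷ (1 , 3) ∷ (2 , 0) ∷ (2 , 1) ∷ (2 , 2) ∷ (2 , 3) ∷ (3 , 1) ∷ (3 , 2) ∷ (3 , 3) ∷ []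
  in ((p123 , R1) ∼d (p132 , R1))
   × ((p123 , R2) ∼d (p132 , R2))
   × ((p123 , R3) ∼d (p132 , R3))
   × ((p123 , R4) ∼d (p132 , R4))
   × ((p123 , R5) ∼d (p132 , R5))
   × ((p123 , R6) ∼d (p132 , R6))
   × ((p123 , R7) ∼d (p132 , R7))
theorem3p2 =
    123∼d132 ((0 , 0) ∷ (0 , 1) ∷ (0 , 2) ∷ (1 , 0) ∷ (2 , 0) ∷ (2 , 2) ∷ [])
  , 123∼d132 ((0 , 0) ∷ (0 , 1) ∷ (0 , 2) ∷ (1 , 0) ∷ (1 , 2) ∷ (2 , 0) ∷ (2 , 1) ∷ (2 , 3) ∷ (3 , 2) ∷ [])
  , 123∼d132 ((0 , 0) ∷ (0 , 1) ∷ (0 , 2) ∷ (1 , 0) ∷ (1 , 1) ∷ (1 , 3) ∷ (2 , 0) ∷ (3 , 1) ∷ (3 , 3) ∷ [])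
  , 123∼d132 ((0 , 0) ∷ (0 , 1) ∷ (0 , 2) ∷ (1 , 0) ∷ (1 , 1) ∷ (1 , 3) ∷ (2 , 0) ∷ (2 , 2) ∷ (3 , 1) ∷ (3 , 3) ∷ [])
  , 123∼d132 ((0 , 0) ∷ (0 , 1) ∷ (0 , 2) ∷ (1 , 0) ∷ (1 , 2) ∷ (2 , 0) ∷ (2 , 1) ∷ (2 , 2) ∷ (2 , 3) ∷ (3 , 2) ∷ [])
  , 123∼d132 ((0 , 0) ∷ (0 , 1) ∷ (0 , 2) ∷ (1 , 0) ∷ (1 , 1) ∷ (1 , 2) ∷ (1 , 3) ∷ (2 , 0) ∷ (2 , 1) ∷ (2 , 3) ∷ (3 , 1) ∷ (3 , 2) ∷ (3 , 3) ∷ [])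
  , 123∼d132 ((0 , 0) ∷ (0 , 1) ∷ (0 , 2) ∷ (1 , 0) ∷ (1 , 1) ∷ (1 , 2) ∷ (1 , 3) ∷ (2 , 0) ∷ (2 , 1) ∷ (2 , 2) ∷ (2 , 3) ∷ (3 , 1) ∷ (3 , 2) ∷ (3 , 3) ∷ [])
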